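{- The function $\mathrm{enc}$ from formulas of propositional logic to $\mathbb{N}$ defined recursively by $$\mathrm{enc}(p_n)=\pi(0,n+1),\quad \mathrm{enc}(\bot)=0,\quad \mathrm{enc}(\varphi\wedge\psi)=\pi(\pi(\mathrm{enc}(\varphi),1),\mathrm{enc}(\psi)),$$ $$\mathrm{enc}(\varphi\vee\psi)=\pi(\pi(\mathrm{enc}(\varphi),2),\mathrm{enc}(\psi)),\quad \mathrm{enc}(\varphi\to\psi)=\pi(\pi(\mathrm{enc}(\varphi),3),\mathrm{enc}(\psi)),$$ where $\pi(x,y)=(x+y)(x+y+1)+2x$ for $x,y\in\mathbb{N}$, is injective. Consequently the set of formulas is countable.
   Context: Formulas are built freely (as an inductive type) from propositional variables $p_n$ ($n\in\mathbb{N}$, with $p_n\ne p_m$ for $n\neq m$) and $\bot$ by the binary connectives $\wedge,\vee,\to$. $\mathbb{N}$ includes $0$. A set is countable if it admits an injection into $\mathbb{N}$. -}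

module Defs where

open import Data.Nat using (ℕ; _+_; _*_)
open import Function.Bundles using (_↣_)

infixr 7 _∧_
infixr 6 _∨_
infixr 5 _⇒_

data Formula : Set where
  var         : ℕ → Formula
  ⊥           : Formula
  _∧_ _∨_ _⇒_ : Formula → Formula → Formula

-- Twice the Cantor pairing function, which avoids the division by 2.
π : ℕ → ℕ → ℕ
π x y = (x + y) * (x + y + 1) + 2 * x

enc : Formula → ℕ
enc (var n) = π 0 (n + 1)
enc ⊥       = 0
enc (φ ∧ ψ) = π (π (enc φ) 1) (enc ψ)
enc (φ ∨ ψ) = π (π (enc φ) 2) (enc ψ)
enc (φ ⇒ ψ) = π (π (enc φ) 3) (enc ψ)

Countable : Set → Set
Countable A = A ↣ ℕ

{-# OPTIONS --safe #-}
-- Write s = x + y.  Then s (s + 1) ≤ π x y < (s + 1) (s + 2), so π x y determines s,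
-- hence 2 x and y.  The encodings of p_n and ⊥ have first component 0 (as 0 = π 0 0),
-- whereas those of compound formulas have first component π a k with k ≠ 0, which is
-- not π 0 0; here k is the tag of the connective.
module Submission where

open import Relation.Binary.PropositionalEquality
  using (_≡_; _≢_; refl; sym; trans; cong; cong₂)
open import Relation.Binary.Definitions using (tri<; tri≈; tri>)
open import Relation.Nullary using (contradiction)
open import Data.Nat using (ℕ; suc; _+_; _*_; _<_; s≤s; z≤n)
open import Data.Nat.Properties
open import Data.Nat.Tactic.RingSolver using (solve-∀)
open import Data.Product using (_×_; _,_; proj₂)
open import Function.Bundles using (mk↣)
open import Function.Definitions using (Injective)
open import Defs

-- Numbers with a fixed sum `s` lie in the block from one oblong number `s * (s + 1)` up to, but
-- excluding, the next; blocks of different sums are disjoint and ordered.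
π-mono-sum : ∀ {x y x′ y′} → x + y < x′ + y′ → π x y < π x′ y′
π-mono-sum {x} {y} {x′} {y′} s<s′ = begin-strict
  s * (s + 1) + 2 * x        ≤⟨ +-monoʳ-≤ (s * (s + 1)) (*-monoʳ-≤ 2 (m≤m+n x y)) ⟩
  -- Even the largest value in the block, at `x = s`, falls short of the next oblong number by 2;
  -- this slack gives strictness.
  s * (s + 1) + 2 * s        <⟨ m<m+n _ (s≤s z≤n) ⟩
  s * (s + 1) + 2 * s + 2    ≡⟨ next-oblong s ⟩
  suc s * (suc s + 1)        ≤⟨ *-mono-≤ s<s′ (+-monoˡ-≤ 1 s<s′) ⟩
  s′ * (s′ + 1)              ≤⟨ m≤m+n _ (2 * x′) ⟩
  s′ * (s′ + 1) + 2 * x′     ∎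
  where
  open ≤-Reasoning
  s s′ : ℕ
  s  = x + y
  s′ = x′ + y′
  next-oblong : ∀ n → n * (n + 1) + 2 * n + 2 ≡ suc n * (suc n + 1)
  next-oblong = solve-∀

π-injective : ∀ {x y x′ y′} → π x y ≡ π x′ y′ → x ≡ x′ × y ≡ y′
π-injective {x} {y} {x′} {y′} eq with <-cmp (x + y) (x′ + y′)
... | tri< s<s′ _ _ = contradiction eq (<⇒≢ (π-mono-sum {x} {y} {x′} {y′} s<s′))
... | tri> _ _ s′<s = contradiction (sym eq) (<⇒≢ (π-mono-sum {x′} {y′} {x} {y} s′<s))
... | tri≈ _ s≡s′ _ = x≡x′ , +-cancelˡ-≡ x y y′ (trans s≡s′ (cong (_+ y′) (sym x≡x′)))
  where
  x≡x′ : x ≡ x′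
  -- Once `s′` is replaced by `s`, the quadratic terms on both sides coincide and cancel, leaving
  -- `2 * x ≡ 2 * x′`.
  x≡x′ = *-cancelˡ-≡ x x′ 2 (+-cancelˡ-≡ ((x + y) * (x + y + 1)) _ _
    (trans eq (cong (λ s → s * (s + 1) + 2 * x′) (sym s≡s′))))

-- The common shape of the compound clauses of `enc`, with `k` equal to 1, 2, 3 for `∧`, `∨`, `⇒`.
tagged : ℕ → ℕ → ℕ → ℕ
tagged k a b = π (π a k) b

tagged-injective : ∀ {j k a a′ b b′} → tagged j a b ≡ tagged k a′ b′ →
                   j ≡ k × a ≡ a′ × b ≡ b′
tagged-injective {j} {k} {a} {a′} {b} {b′} eq
  with πa≡πa′ , b≡b′ ← π-injective {π a j} {b} {π a′ k} {b′} eq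
  with a≡a′ , j≡k ← π-injective {a} {j} {a′} {k} πa≡πa′
  = j≡k , a≡a′ , b≡b′

-- Here `c` is `n + 1` for a variable and `0` for `⊥`. Unpairing once leaves `π a (suc k) ≡ 0`;
-- reading `0` as `π 0 0` and unpairing again leaves `suc k ≡ 0`.
tagged≢atom : ∀ k a b c → tagged (suc k) a b ≢ π 0 c
tagged≢atom k a b c eq
  with πa≡0 , _ ← π-injective {π a (suc k)} {b} {0} {c} eq
  with _ , () ← π-injective {a} {suc k} {0} {0} πa≡0

enc-injective : ∀ φ ψ → enc φ ≡ enc ψ → φ ≡ ψ
enc-injective (var m) (var n) eq =
  cong var (+-cancelʳ-≡ 1 m n (proj₂ (π-injective {0} {m + 1} {0} {n + 1} eq)))
-- The shift in `π 0 (m + 1)` is what separates the variable with index 0 from `⊥`, whose code is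
-- `π 0 0`.
enc-injective (var m) ⊥ eq =
  contradiction (proj₂ (π-injective {0} {m + 1} {0} {0} eq)) (m+1+n≢0 m)
enc-injective ⊥ (var n) eq =
  contradiction (proj₂ (π-injective {0} {n + 1} {0} {0} (sym eq))) (m+1+n≢0 n)
enc-injective ⊥ ⊥ _ = refl
-- The numeral passed is the predecessor of the tag: 0, 1, 2 for `∧`, `∨`, `⇒`.
enc-injective (var m) (φ ∧ ψ) eq = contradiction (sym eq) (tagged≢atom 0 (enc φ) (enc ψ) (m + 1))
enc-injective (var m) (φ ∨ ψ) eq = contradiction (sym eq) (tagged≢atom 1 (enc φ) (enc ψ) (m + 1))
enc-injective (var m) (φ ⇒ ψ) eq = contradiction (sym eq) (tagged≢atom 2 (enc φ) (enc ψ) (m + 1))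
enc-injective ⊥ (φ ∧ ψ) eq = contradiction (sym eq) (tagged≢atom 0 (enc φ) (enc ψ) 0)
enc-injective ⊥ (φ ∨ ψ) eq = contradiction (sym eq) (tagged≢atom 1 (enc φ) (enc ψ) 0)
enc-injective ⊥ (φ ⇒ ψ) eq = contradiction (sym eq) (tagged≢atom 2 (enc φ) (enc ψ) 0)
enc-injective (φ ∧ ψ) (var n) eq = contradiction eq (tagged≢atom 0 (enc φ) (enc ψ) (n + 1))
enc-injective (φ ∨ ψ) (var n) eq = contradiction eq (tagged≢atom 1 (enc φ) (enc ψ) (n + 1))
enc-injective (φ ⇒ ψ) (var n) eq = contradiction eq (tagged≢atom 2 (enc φ) (enc ψ) (n + 1))
enc-injective (φ ∧ ψ) ⊥ eq = contradiction eq (tagged≢atom 0 (enc φ) (enc ψ) 0)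
enc-injective (φ ∨ ψ) ⊥ eq = contradiction eq (tagged≢atom 1 (enc φ) (enc ψ) 0)
enc-injective (φ ⇒ ψ) ⊥ eq = contradiction eq (tagged≢atom 2 (enc φ) (enc ψ) 0)
enc-injective (φ ∧ ψ) (φ′ ∧ ψ′) eq
  with _ , l , r ← tagged-injective {1} {1} {enc φ} {enc φ′} {enc ψ} {enc ψ′} eq
  = cong₂ _∧_ (enc-injective φ φ′ l) (enc-injective ψ ψ′ r)
-- Different connectives would force their tags to be equal, here `1 ≡ 2`, which the absurd pattern
-- refutes.
enc-injective (φ ∧ ψ) (φ′ ∨ ψ′) eq
  with () , _ ← tagged-injective {1} {2} {enc φ} {enc φ′} {enc ψ} {enc ψ′} eq
enc-injective (φ ∧ ψ) (φ′ ⇒ ψ′) eq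
  with () , _ ← tagged-injective {1} {3} {enc φ} {enc φ′} {enc ψ} {enc ψ′} eq
enc-injective (φ ∨ ψ) (φ′ ∧ ψ′) eq
  with () , _ ← tagged-injective {2} {1} {enc φ} {enc φ′} {enc ψ} {enc ψ′} eq
enc-injective (φ ∨ ψ) (φ′ ∨ ψ′) eq
  with _ , l , r ← tagged-injective {2} {2} {enc φ} {enc φ′} {enc ψ} {enc ψ′} eq
  = cong₂ _∨_ (enc-injective φ φ′ l) (enc-injective ψ ψ′ r)
enc-injective (φ ∨ ψ) (φ′ ⇒ ψ′) eq
  with () , _ ← tagged-injective {2} {3} {enc φ} {enc φ′} {enc ψ} {enc ψ′} eq
enc-injective (φ ⇒ ψ) (φ′ ∧ ψ′) eq
  with () , _ ← tagged-injective {3} {1} {enc φ} {enc φ′} {enc ψ} {enc ψ′} eq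
enc-injective (φ ⇒ ψ) (φ′ ∨ ψ′) eq
  with () , _ ← tagged-injective {3} {2} {enc φ} {enc φ′} {enc ψ} {enc ψ′} eq
enc-injective (φ ⇒ ψ) (φ′ ⇒ ψ′) eq
  with _ , l , r ← tagged-injective {3} {3} {enc φ} {enc φ′} {enc ψ} {enc ψ′} eq
  = cong₂ _⇒_ (enc-injective φ φ′ l) (enc-injective ψ ψ′ r)

mainTheorem4 : Injective _≡_ _≡_ enc × Countable Formula
mainTheorem4 = injective , mk↣ injective
  where
  injective : Injective _≡_ _≡_ enc
  injective {φ} {ψ} = enc-injective φ ψ
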